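{- The deterministic online algorithm $\mathrm{Det}$ (defined in the context) is $(2n-2)$-competitive when the graph is either a collection of lines or a collection of cliques. That is, for every node set $V$ with $|V|=n$ and every instance $\sigma=(\pi_0;G_0,\dots,G_k)$ on $V$ that is a line instance or a clique instance, and for any way of breaking ties in $\mathrm{Det}$, $$\mathrm{Det}(\sigma)\le (2n-2)\cdot\mathrm{Opt}(\sigma).$$
   Context: Let $V$ be a set of $n$ nodes. A permutation is a bijection $\pi:V\to\{1,\dots,n\}$. A MinLA of a graph $G=(V,E)$ is a permutation $\pi$ minimizing $\sum_{\{x,y\}\in E}|\pi(x)-\pi(y)|$ among all permutations. $d(\pi,\pi')$ is the Kendall tau distance: the minimum number of swaps of adjacent elements transforming $\pi$ into $\pi'$. An instance consists of an arbitrary initial permutation $\pi_0$ and a sequence $G_0,\dots,G_k$ of graphs on $V$ where $G_0$ has no edges. In a clique instance, every $G_i$ is a disjoint union of cliques (isolated nodes are cliques of size one) and $G_{i+1}$ is obtained from $G_i$ by merging exactly two cliques into one. In a line instance, every $G_i$ is a disjoint union of paths (isolated nodes are paths with one node) and $G_{i+1}$ is obtained from $G_i$ by adding one edge between two distinct components. Feasible solution: permutations $\pi_1,\dots,\pi_k$ such that $\pi_i$ is a MinLA of $G_i$ for each $i$; its cost is $\sum_{i=0}^{k-1}d(\pi_i,\pi_{i+1})$. An online algorithm must choose $\pi_i$ knowing only $\pi_0,G_0,\dots,G_i$. $\mathrm{Opt}(\sigma)$ is the minimum cost of a feasible solution of $\sigma$. A deterministic algorithm is $c$-competitive if its cost on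 every instance $\sigma$ is at most $c\cdot\mathrm{Opt}(\sigma)$. Algorithm $\mathrm{Det}$: when $G_i$ is revealed, choose as $\pi_i$ an arbitrary permutation minimizing $d(\pi_0,\pi)$ among all MinLAs $\pi$ of $G_i$. $\mathrm{Det}(\sigma)$ denotes its cost on $\sigma$. -}

module Defs where

open import Data.Fin.Base using (Fin; zero; suc; toℕ; inject₁; fromℕ<)
open import Data.Fin.Permutation using (Permutation′; transpose; inverseˡ; inverseʳ)
import Data.Fin.Permutation.Components as PC
open import Data.Fin.Permutation.Transposition.List using (TranspositionList; eval; decompose; eval-decompose)
open import Data.Fin.Properties using (any?; all?; toℕ-injective; toℕ-fromℕ<; toℕ<n; _≟_)
open import Data.List.Base using (List; []; _∷_; map)
open import Data.List.Membership.Propositional using (_∈_)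
open import Data.List.Properties using (map-cong)
open import Data.List.Relation.Unary.All using (All)
open import Data.List.Relation.Unary.AllPairs using (AllPairs)
open import Data.Nat.Base as ℕ using (ℕ; zero; suc; _+_; _≤_; _<_; z≤n; s≤s; ∣_-_∣)
open import Data.Nat.ListAction using (sum)
import Data.Nat.Properties as ℕ
open import Algebra.Properties.Monoid.Sum ℕ.+-0-monoid using (sum-syntax; sum-cong-≗)
open import Data.Product.Base using (∃; ∃₂; Σ-syntax; ∃-syntax; _×_; _,_; proj₁; proj₂)
open import Data.Sum.Base using (_⊎_; inj₁; inj₂)
open import Data.Vec.Functional as Vector using (Vector)
open import Function.Base using (_∘_)
open import Function.Bundles using (_↔_; _⇔_; Inverse; mk↔ₛ′)
open import Function.Construct.Composition using (_↔-∘_)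
open import Function.Construct.Symmetry using (↔-sym)
open import Function.Definitions using (Injective)
open import Relation.Binary.Construct.Closure.ReflexiveTransitive using (Star)
open import Relation.Binary.Core using (Rel)
open import Relation.Binary.Definitions using (tri<; tri≈; tri>)
open import Relation.Binary.PropositionalEquality
  using (_≡_; _≢_; refl; sym; trans; cong; cong₂; subst)
open import Relation.Nullary using (¬_; Dec; yes; no; contradiction)
open import Relation.Nullary.Decidable using (map′; _×-dec_)
open import Level using (0ℓ)

private
  variable
    V : Set
    n : ℕ

Least : (ℕ → Set) → ℕ → Set
Least P m = P m × (∀ {k} → P k → m ≤ k)

search : ∀ {P : ℕ → Set} → (∀ m → Dec (P m)) → ∀ m → P m → ∃ (Least P)
search P? zero    p = zero , p , λ _ → z≤n
search {P} P? (suc m) p with P? zero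
... | yes p₀ = zero , p₀ , λ _ → z≤n
... | no ¬p₀ with search (P? ∘ suc) m p
...   | j , pj , minimal = suc j , pj , bound
  where
  bound : ∀ {k} → P k → suc j ≤ k
  bound {zero}  p₀ = contradiction p₀ ¬p₀
  bound {suc k} pk = s≤s (minimal pk)

abstract
  least : ∀ {P : ℕ → Set} → (∀ m → Dec (P m)) → ∃ P → ∃ (Least P)
  least P? (m , p) = search P? m p

-- Positions are 0, …, n-1 rather than 1, …, n.  An inhabitant of Perm V n
-- witnesses |V| = n.
Perm : Set → ℕ → Set
Perm V n = V ↔ Fin n

infix 4 _≈_

-- Inhabitants of Perm V n also contain proofs, so they are compared as
-- functions.
_≈_ : Rel (Perm V n) 0ℓ
π ≈ π′ = ∀ x → Inverse.to π x ≡ Inverse.to π′ x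

swapAt : Fin n → Fin n → Perm V n → Perm V n
swapAt i j π = transpose i j ↔-∘ π

infix 4 _⟶⟨_⟩_

-- π ⟶⟨ m ⟩ π′ : some sequence of m swaps of adjacent elements
-- transforms π into π′.
data _⟶⟨_⟩_ (π : Perm V n) : ℕ → Perm V n → Set where
  done : ∀ {π′} → π ≈ π′ → π ⟶⟨ 0 ⟩ π′
  swap : ∀ {m π′} (i j : Fin n) → toℕ j ≡ suc (toℕ i) →
         swapAt i j π ⟶⟨ m ⟩ π′ → π ⟶⟨ suc m ⟩ π′

⟶-respˡ : ∀ {π π′ ρ : Perm V n} {m} → π ≈ π′ → π ⟶⟨ m ⟩ ρ → π′ ⟶⟨ m ⟩ ρ
⟶-respˡ e (done e′)      = done λ x → trans (sym (e x)) (e′ x)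
⟶-respˡ e (swap i j a r) = swap i j a (⟶-respˡ (λ x → cong (PC.transpose i j) (e x)) r)

⟶-respʳ : ∀ {π ρ ρ′ : Perm V n} {m} → ρ ≈ ρ′ → π ⟶⟨ m ⟩ ρ → π ⟶⟨ m ⟩ ρ′
⟶-respʳ e (done e′)      = done λ x → trans (e′ x) (e x)
⟶-respʳ e (swap i j a r) = swap i j a (⟶-respʳ e r)

⟶-trans : ∀ {π ρ τ : Perm V n} {m l} → π ⟶⟨ m ⟩ ρ → ρ ⟶⟨ l ⟩ τ → π ⟶⟨ m + l ⟩ τ
⟶-trans (done e)       s = ⟶-respˡ (λ x → sym (e x)) s
⟶-trans (swap i j a r) s = swap i j a (⟶-trans r s)

⟶? : ∀ m (π π′ : Perm V n) → Dec (π ⟶⟨ m ⟩ π′)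
⟶? zero π π′ = map′
  (λ h → done λ x → trans (cong (Inverse.to π) (sym (inverse π x)))
                    (trans (h (Inverse.to π x)) (cong (Inverse.to π′) (inverse π x))))
  (λ { (done e) i → e _ })
  (all? λ i → Inverse.to π (Inverse.from π i) ≟ Inverse.to π′ (Inverse.from π i))
  where
  inverse : ∀ (ρ : Perm V n) x → Inverse.from ρ (Inverse.to ρ x) ≡ x
  inverse ρ x = Inverse.inverseʳ ρ refl
⟶? (suc m) π π′ = map′
  (λ { (i , j , a , r) → swap i j a r })
  (λ { (swap i j a r) → i , j , a , r })
  (any? λ i → any? λ j → (toℕ j ℕ.≟ suc (toℕ i)) ×-dec ⟶? m (swapAt i j π) π′)

transposeˡ : ∀ (i j k : Fin n) → k ≡ i → PC.transpose i j k ≡ j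
transposeˡ i j k k≡i with k ≟ i
... | yes _   = refl
... | no  k≢i = contradiction k≡i k≢i

transposeʳ : ∀ (i j k : Fin n) → k ≡ j → PC.transpose i j k ≡ i
transposeʳ i j k k≡j with k ≟ i
... | yes k≡i = trans (sym k≡j) k≡i
... | no  _   with k ≟ j
...   | yes _   = refl
...   | no  k≢j = contradiction k≡j k≢j

transpose-other : ∀ (i j k : Fin n) → k ≢ i → k ≢ j → PC.transpose i j k ≡ k
transpose-other i j k k≢i k≢j with k ≟ i
... | yes k≡i = contradiction k≡i k≢i
... | no  _   with k ≟ j
...   | yes k≡j = contradiction k≡j k≢j
...   | no  _   = refl

transpose-sym : ∀ (i j k : Fin n) → PC.transpose i j k ≡ PC.transpose j i k
transpose-sym i j k with k ≟ i
... | yes k≡i = sym (transposeʳ j i k k≡i)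
... | no  k≢i with k ≟ j
...   | yes k≡j = refl
...   | no  k≢j with k ≟ i
...     | yes k≡i = contradiction k≡i k≢i
...     | no  _   = refl

transpose-conj : ∀ (i j l : Fin n) → i ≢ j → i ≢ l → j ≢ l → ∀ k →
  PC.transpose j l (PC.transpose i j (PC.transpose j l k)) ≡ PC.transpose i l k
transpose-conj i j l i≢j i≢l j≢l k = go (k ≟ i) (k ≟ j) (k ≟ l)
  where
  T = PC.transpose
  go : Dec (k ≡ i) → Dec (k ≡ j) → Dec (k ≡ l) → T j l (T i j (T j l k)) ≡ T i l k
  go (yes refl) _ _
    rewrite transpose-other j l k i≢j i≢l | transposeˡ k j k refl
          | transposeˡ j l j refl | transposeˡ k l k refl = refl
  go (no k≢i) (yes refl) _
    rewrite transposeˡ k l k refl | transpose-other i k l (i≢l ∘ sym) (j≢l ∘ sym)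
          | transposeʳ k l l refl | transpose-other i l k k≢i j≢l = refl
  go (no k≢i) (no k≢j) (yes refl)
    rewrite transposeʳ j k k refl | transposeʳ i j j refl
          | transpose-other j k i i≢j i≢l | transposeʳ i k k refl = refl
  go (no k≢i) (no k≢j) (no k≢l)
    rewrite transpose-other j l k k≢j k≢l | transpose-other i j k k≢i k≢j
          | transpose-other j l k k≢j k≢l | transpose-other i l k k≢i k≢l = refl

exchange-< : ∀ g (i l : Fin n) → toℕ l ≡ suc (g + toℕ i) →
             ∀ (π : Perm V n) → ∃ λ m → π ⟶⟨ m ⟩ swapAt i l π
exchange-< zero    i l eq π = 1 , swap i l eq (done λ _ → refl)
exchange-< {n} (suc g) i l eq π = _ ,
  swap j l eq′ (⟶-trans (proj₂ (exchange-< g i j toℕ-j (swapAt j l π)))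
                        (swap j l eq′ (done λ x → transpose-conj i j l i≢j i≢l j≢l (Inverse.to π x))))
  where
  j<n : suc (g + toℕ i) < n
  j<n = ℕ.<-trans (ℕ.≤-reflexive (sym eq)) (toℕ<n l)
  j = fromℕ< j<n
  toℕ-j : toℕ j ≡ suc (g + toℕ i)
  toℕ-j = toℕ-fromℕ< j<n
  eq′ : toℕ l ≡ suc (toℕ j)
  eq′ = trans eq (cong suc (sym toℕ-j))
  <⇒≢ : ∀ {a b : Fin n} → toℕ a < toℕ b → a ≢ b
  <⇒≢ a<b refl = ℕ.<-irrefl refl a<b
  j≢l : j ≢ l
  j≢l = <⇒≢ (ℕ.≤-reflexive (sym eq′))
  i<j : toℕ i < toℕ j
  i<j = subst (toℕ i <_) (sym toℕ-j) (s≤s (ℕ.m≤n+m (toℕ i) g))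
  i≢j : i ≢ j
  i≢j = <⇒≢ i<j
  i≢l : i ≢ l
  i≢l = <⇒≢ (ℕ.<-trans i<j (ℕ.≤-reflexive (sym eq′)))

exchange : ∀ (i j : Fin n) (π : Perm V n) → ∃ λ m → π ⟶⟨ m ⟩ swapAt i j π
exchange i j π with ℕ.<-cmp (toℕ i) (toℕ j)
... | tri< i<j _ _ = exchange-< (toℕ j ℕ.∸ suc (toℕ i)) i j
        (trans (sym (ℕ.m∸n+n≡m i<j)) (ℕ.+-suc _ _)) π
... | tri≈ _ i≡j _ = 0 , done λ x → sym (trivial (Inverse.to π x))
  where
  trivial : ∀ k → PC.transpose i j k ≡ k
  trivial k with k ≟ i
  ... | yes k≡i = trans (sym (toℕ-injective i≡j)) (sym k≡i)
  ... | no  k≢i with k ≟ j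
  ...   | yes k≡j = contradiction (trans k≡j (sym (toℕ-injective i≡j))) k≢i
  ...   | no  _   = refl
... | tri> _ _ j<i with exchange-< (toℕ i ℕ.∸ suc (toℕ j)) j i
        (trans (sym (ℕ.m∸n+n≡m j<i)) (ℕ.+-suc _ _)) π
...   | m , r = m , ⟶-respʳ (λ x → transpose-sym j i (Inverse.to π x)) r

apply : ∀ (ts : TranspositionList n) (π : Perm V n) → ∃ λ m → π ⟶⟨ m ⟩ (eval ts ↔-∘ π)
apply []             π = 0 , done λ _ → refl
apply ((i , j) ∷ ts) π with exchange i j π | apply ts (swapAt i j π)
... | m , r | l , s = m + l , ⟶-trans r s

reachable : ∀ (π π′ : Perm V n) → ∃ λ m → π ⟶⟨ m ⟩ π′
reachable π π′ with apply (decompose (π′ ↔-∘ ↔-sym π)) π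
... | m , r = m , ⟶-respʳ
  (λ x → trans (eval-decompose (π′ ↔-∘ ↔-sym π) (Inverse.to π x))
               (cong (Inverse.to π′) (Inverse.inverseʳ π refl))) r

d-exists : ∀ (π π′ : Perm V n) → ∃ (Least (π ⟶⟨_⟩ π′))
d-exists π π′ = least (λ m → ⟶? m π π′) (reachable π π′)

d : Perm V n → Perm V n → ℕ
d π π′ = proj₁ (d-exists π π′)

Least-unique : ∀ {P Q : ℕ → Set} {m l} → (∀ {k} → P k → Q k) → (∀ {k} → Q k → P k) →
               Least P m → Least Q l → m ≡ l
Least-unique to from (p , p-min) (q , q-min) = ℕ.≤-antisym (p-min (from q)) (q-min (to p))

d-cong : ∀ {π π′ ρ ρ′ : Perm V n} → π ≈ π′ → ρ ≈ ρ′ → d π ρ ≡ d π′ ρ′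
d-cong {π = π} {π′} {ρ} {ρ′} e f = Least-unique
  (⟶-respˡ e ∘ ⟶-respʳ f)
  (⟶-respˡ (λ x → sym (e x)) ∘ ⟶-respʳ (λ x → sym (f x)))
  (proj₂ (d-exists π ρ)) (proj₂ (d-exists π′ ρ′))

-- (x , y) and (x′ , y′) are the same unordered pair.
SameEdge : Rel (V × V) 0ℓ
SameEdge (x , y) (x′ , y′) = (x ≡ x′ × y ≡ y′) ⊎ (x ≡ y′ × y ≡ x′)

-- Each edge {x, y} is listed exactly once, in one of its two orientations.
record Graph (V : Set) : Set where
  field
    edges    : List (V × V)
    loopless : All (λ (x , y) → x ≢ y) edges
    distinct : AllPairs (λ e f → ¬ SameEdge e f) edges

open Graph public

Adj : Graph V → Rel V 0ℓ
Adj G x y = (x , y) ∈ edges G ⊎ (y , x) ∈ edges G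

Connected : Graph V → Rel V 0ℓ
Connected G = Star (Adj G)

arrangementCost : Graph V → Perm V n → ℕ
arrangementCost G π =
  sum (map (λ (x , y) → ∣ toℕ (Inverse.to π x) - toℕ (Inverse.to π y) ∣) (edges G))

IsMinLA : Graph V → Perm V n → Set
IsMinLA {V} {n} G π = ∀ (π′ : Perm V n) → arrangementCost G π ≤ arrangementCost G π′

IsCliqueUnion : Graph V → Set
IsCliqueUnion G = ∀ {x y} → Connected G x y → x ≢ y → Adj G x y

-- Every component is a path p 0, p 1, …, p (m - 1).
IsPathUnion : Graph V → Set
IsPathUnion {V} G = ∀ (v : V) → ∃[ m ] Σ[ p ∈ (Fin m → V) ]
  Injective _≡_ _≡_ p ×
  (∀ x → Connected G v x ⇔ (∃[ i ] p i ≡ x)) ×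
  (∀ i j → Adj G (p i) (p j) ⇔ (∣ toℕ i - toℕ j ∣ ≡ 1))

-- G′ is G with all edges between the components of a and b added.
MergesTwoComponents : Rel (Graph V) 0ℓ
MergesTwoComponents {V} G G′ = ∃₂ λ (a b : V) → ¬ Connected G a b ×
  (∀ x y → Adj G′ x y ⇔
    (Adj G x y ⊎ (Connected G a x × Connected G b y) ⊎ (Connected G b x × Connected G a y)))

AddsEdge : Rel (Graph V) 0ℓ
AddsEdge {V} G G′ = ∃₂ λ (a b : V) → ¬ Connected G a b ×
  (∀ x y → Adj G′ x y ⇔ (Adj G x y ⊎ (x ≡ a × y ≡ b) ⊎ (x ≡ b × y ≡ a)))

record Instance (V : Set) (n : ℕ) : Set where
  field
    π₀    : Perm V n
    k     : ℕ
    G     : Fin (suc k) → Graph V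
    empty : edges (G zero) ≡ []

IsCliqueInstance : Instance V n → Set
IsCliqueInstance σ =
  (∀ i → IsCliqueUnion (G i)) × (∀ (i : Fin k) → MergesTwoComponents (G (inject₁ i)) (G (suc i)))
  where open Instance σ

IsLineInstance : Instance V n → Set
IsLineInstance σ =
  (∀ i → IsPathUnion (G i)) × (∀ (i : Fin k) → AddsEdge (G (inject₁ i)) (G (suc i)))
  where open Instance σ

-- The permutations π₁, …, πₖ; the entry at i : Fin k is πᵢ₊₁.
Solution : Instance V n → Set
Solution {V} {n} σ = Vector (Perm V n) (Instance.k σ)

Feasible : (σ : Instance V n) → Solution σ → Set
Feasible σ π = ∀ i → IsMinLA (G (suc i)) (π i)
  where open Instance σ

cost : (σ : Instance V n) → Solution σ → ℕ
cost σ π = ∑[ i < k ] d (π₀,π (inject₁ i)) (π₀,π (suc i))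
  where
  open Instance σ
  π₀,π = π₀ Vector.∷ π

IsOpt : Instance V n → ℕ → Set
IsOpt σ = Least λ c → ∃[ π ] Feasible σ π × cost σ π ≡ c

-- A run of Det on σ, for an arbitrary tie-breaking.
IsDetRun : (σ : Instance V n) → Solution σ → Set
IsDetRun σ π = ∀ i → IsMinLA (G (suc i)) (π i) ×
  (∀ π′ → IsMinLA (G (suc i)) π′ → d π₀ (π i) ≤ d π₀ π′)
  where open Instance σ

Searchable : (A : Set) → Rel A 0ℓ → Set₁
Searchable A _∼_ = ∀ {P : A → Set} → (∀ {a b} → a ∼ b → P a → P b) → (∀ a → Dec (P a)) → Dec (∃ P)

Pointwise : ∀ {A : Set} → Rel A 0ℓ → ∀ m → Rel (Vector A m) 0ℓ
Pointwise _∼_ m f g = ∀ i → f i ∼ g i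

Vector-searchable : ∀ {A : Set} (_∼_ : Rel A 0ℓ) → (∀ {a} → a ∼ a) →
                    Searchable A _∼_ → ∀ m → Searchable (Vector A m) (Pointwise _∼_ m)
Vector-searchable _∼_ ∼-refl search zero resp P? =
  map′ (Vector.[] ,_) (λ (f , p) → resp {f} {Vector.[]} (λ ()) p) (P? Vector.[])
Vector-searchable _∼_ ∼-refl search (suc m) {P} resp P? = map′
  (λ (a , f , p) → (a Vector.∷ f) , p)
  (λ (f , p) → f zero , f ∘ suc , resp (λ { zero → ∼-refl ; (suc i) → ∼-refl }) p)
  (search (λ a∼b (f , p) → f , resp (λ { zero → a∼b ; (suc i) → ∼-refl }) p)
    λ a → Vector-searchable _∼_ ∼-refl search m
      (λ f∼g → resp λ { zero → ∼-refl ; (suc i) → f∼g i })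
      λ f → P? (a Vector.∷ f))

Permutation-searchable : Searchable (Permutation′ n) _≈_
Permutation-searchable {n} {P} resp P? = map′
  (λ (f , g , ρ , _ , _ , p) → ρ , p)
  (λ (ρ , p) → Inverse.to ρ , Inverse.from ρ , ρ , (λ _ → refl) , (λ _ → refl) , p)
  (functions (λ f∼f′ (g , ρ , e , e′ , p) → g , ρ , (λ i → trans (e i) (f∼f′ i)) , e′ , p) λ f →
   functions (λ g∼g′ (ρ , e , e′ , p) → ρ , e , (λ i → trans (e′ i) (g∼g′ i)) , p) λ g → check f g)
  where
  functions : Searchable (Vector (Fin n) n) (Pointwise _≡_ n)
  functions = Vector-searchable _≡_ refl (λ _ → any?) n

  check : ∀ f g → Dec (∃ λ (ρ : Permutation′ n) →
    (∀ i → Inverse.to ρ i ≡ f i) × (∀ i → Inverse.from ρ i ≡ g i) × P ρ)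
  check f g with all? (λ i → f (g i) ≟ i) | all? (λ i → g (f i) ≟ i)
  ... | no ¬fg | _ = no λ (ρ , e , e′ , _) → ¬fg λ i →
    trans (sym (trans (cong (Inverse.to ρ) (e′ i)) (e (g i)))) (inverseʳ ρ)
  ... | yes _ | no ¬gf = no λ (ρ , e , e′ , _) → ¬gf λ i →
    trans (sym (trans (cong (Inverse.from ρ) (e i)) (e′ (f i)))) (inverseˡ ρ)
  ... | yes fg | yes gf = map′
    (λ p → mk↔ₛ′ f g fg gf , (λ _ → refl) , (λ _ → refl) , p)
    (λ (ρ , e , _ , p) → resp e p)
    (P? (mk↔ₛ′ f g fg gf))

Perm-searchable : Perm V n → Searchable (Perm V n) _≈_
Perm-searchable π₀ resp P? = map′
  (λ (ρ , p) → (ρ ↔-∘ π₀) , p)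
  (λ (π , p) → (π ↔-∘ ↔-sym π₀) , resp (λ x → cong (Inverse.to π) (sym (Inverse.inverseʳ π₀ refl))) p)
  (Permutation-searchable (λ e → resp λ x → e (Inverse.to π₀ x)) λ ρ → P? (ρ ↔-∘ π₀))

arrangementCost-cong : ∀ (G : Graph V) {π π′ : Perm V n} → π ≈ π′ →
                       arrangementCost G π ≡ arrangementCost G π′
arrangementCost-cong G e =
  cong sum (map-cong (λ (x , y) → cong₂ (λ i j → ∣ toℕ i - toℕ j ∣) (e x) (e y)) (edges G))

minLA : ∀ (G : Graph V) → Perm V n → ∃ λ (π : Perm V n) → IsMinLA G π
minLA G π₀ with least
  (λ c → Perm-searchable π₀ (λ {π} {π′} e eq → trans (sym (arrangementCost-cong G {π} {π′} e)) eq)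
           λ π → arrangementCost G π ℕ.≟ c)
  (_ , π₀ , refl)
... | _ , (π , refl) , minimal = π , λ π′ → minimal (π′ , refl)

isMinLA? : ∀ (G : Graph V) (π : Perm V n) → Dec (IsMinLA G π)
isMinLA? G π with minLA G π
... | ρ , ρ-min = map′
  (λ le π′ → ℕ.≤-trans le (ρ-min π′)) (λ π-min → π-min ρ)
  (arrangementCost G π ℕ.≤? arrangementCost G ρ)

IsMinLA-resp : ∀ (G : Graph V) {π π′ : Perm V n} → π ≈ π′ → IsMinLA G π → IsMinLA G π′
IsMinLA-resp G {π} {π′} e π-min ρ = subst (_≤ _) (arrangementCost-cong G {π} {π′} e) (π-min ρ)

cost-cong : ∀ (σ : Instance V n) {π π′ : Solution σ} → (∀ i → π i ≈ π′ i) → cost σ π ≡ cost σ π′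
cost-cong σ {π} {π′} e = sum-cong-≗ λ i → d-cong (e₀ (inject₁ i)) (e₀ (suc i))
  where
  open Instance σ
  e₀ : ∀ i → (π₀ Vector.∷ π) i ≈ (π₀ Vector.∷ π′) i
  e₀ zero    _ = refl
  e₀ (suc i)   = e i

opt-exists : ∀ (σ : Instance V n) → ∃ (IsOpt σ)
opt-exists σ = least
  (λ c → Vector-searchable _≈_ (λ _ → refl) (Perm-searchable π₀) k
    (λ {π} {π′} e (feasible , eq) →
      (λ i → IsMinLA-resp (G (suc i)) {π i} {π′ i} (e i) (feasible i)) ,
      trans (sym (cost-cong σ {π} {π′} e)) eq)
    λ π → all? (λ i → isMinLA? (G (suc i)) (π i)) ×-dec (cost σ π ℕ.≟ c))
  (_ , (λ i → proj₁ (minLA (G (suc i)) π₀)) , (λ i → proj₂ (minLA (G (suc i)) π₀)) , refl)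
  where open Instance σ

Opt : Instance V n → ℕ
Opt σ = proj₁ (opt-exists σ)

{-# OPTIONS --safe #-}
-- Every permutation of Det is at most as far from π₀ as the permutation an
-- optimal solution uses at the same time, hence within Opt of π₀; so each of
-- the k steps of Det costs at most 2 · Opt.  Since every step joins two
-- components of the graph, k ≤ n - 1.
module Submission where

open import Defs
open import Data.Nat using (ℕ; _≤_; _*_; _∸_)
open import Data.Sum using (_⊎_)

open import Data.Fin.Base using (Fin; zero; suc; inject₁; punchOut)
import Data.Fin.Permutation.Components as PC
open import Data.Fin.Properties using (_≟_; punchOut-injective)
open import Data.Nat using (zero; suc; _+_; z≤n; s≤s)
import Data.Nat.Properties as ℕ
open import Algebra.Properties.Monoid.Sum ℕ.+-0-monoid using (sum-syntax)
open import Data.Product using (∃; ∃₂; _×_; _,_; proj₁; proj₂)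
open import Data.Sum as Sum using (inj₁; inj₂)
import Data.Vec.Functional as Vector
open import Function.Base using (_∘_)
open import Function.Bundles using (Inverse; Equivalence)
open import Relation.Binary.Construct.Closure.ReflexiveTransitive
  using (ε; _◅_; _◅◅_; map)
open import Relation.Binary.PropositionalEquality
  using (_≡_; _≢_; refl; sym; trans; cong; subst)
open import Relation.Nullary using (¬_; yes; no; contradiction)

private
  variable
    V : Set
    m n : ℕ

-- The swaps are undone in reverse order, each being its own inverse. The first swap becomes the
-- last, so the length appears as `m + 1`.
⟶-sym : ∀ {π ρ : Perm V n} → π ⟶⟨ m ⟩ ρ → ρ ⟶⟨ m ⟩ π
⟶-sym (done e) = done (sym ∘ e)
⟶-sym {π = π} {ρ} (swap {m = m} i j adjacent r) =
  subst (ρ ⟶⟨_⟩ π) (ℕ.+-comm m 1)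
    (⟶-trans (⟶-sym r) (swap i j adjacent (done undo)))
  where
  undo : ∀ x → PC.transpose i j (PC.transpose i j (Inverse.to π x)) ≡ Inverse.to π x
  undo x = trans (cong (PC.transpose i j) (transpose-sym i j (Inverse.to π x)))
                 (PC.transpose-inverse i j {Inverse.to π x})

d-path : ∀ (π ρ : Perm V n) → π ⟶⟨ d π ρ ⟩ ρ
d-path π ρ = proj₁ (proj₂ (d-exists π ρ))

d-≤ : ∀ {π ρ : Perm V n} → π ⟶⟨ m ⟩ ρ → d π ρ ≤ m
d-≤ {π = π} {ρ} = proj₂ (proj₂ (d-exists π ρ))

d-refl-≤ : ∀ (π : Perm V n) → d π π ≤ m
d-refl-≤ π = ℕ.≤-trans (d-≤ {π = π} {π} (done λ _ → refl)) z≤n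

d-triangle : ∀ (π ρ τ : Perm V n) → d π τ ≤ d π ρ + d ρ τ
d-triangle π ρ τ = d-≤ (⟶-trans (d-path π ρ) (d-path ρ τ))

d-sym-≤ : ∀ (π ρ : Perm V n) → d π ρ ≤ d ρ π
d-sym-≤ π ρ = d-≤ (⟶-sym (d-path ρ π))

-- Triangle inequality along the path from `p zero` up to `p i`; the steps after `i` can only
-- increase the sum.
d≤∑d : ∀ {k} (p : Fin (suc k) → Perm V n) i →
       d (p zero) (p i) ≤ ∑[ j < k ] d (p (inject₁ j)) (p (suc j))
d≤∑d p zero = d-refl-≤ (p zero)
d≤∑d {k = suc k} p (suc i) = ℕ.≤-trans
  (d-triangle (p zero) (p (suc zero)) (p (suc i)))
  (ℕ.+-monoʳ-≤ (d (p zero) (p (suc zero))) (d≤∑d (p ∘ suc) i))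

∑-≤ : ∀ {k b} (f : Fin k → ℕ) → (∀ i → f i ≤ b) → ∑[ i < k ] f i ≤ k * b
∑-≤ {zero}  f f≤b = z≤n
∑-≤ {suc k} f f≤b = ℕ.+-mono-≤ (f≤b zero) (∑-≤ (f ∘ suc) (f≤b ∘ suc))

d-ball : ∀ (π ρ τ : Perm V n) {r} → d π ρ ≤ r → d π τ ≤ r → d ρ τ ≤ 2 * r
d-ball π ρ τ {r} πρ≤r πτ≤r = ℕ.≤-trans (d-triangle ρ π τ) (ℕ.+-mono-≤
  (ℕ.≤-trans (d-sym-≤ ρ π) πρ≤r)
  (ℕ.≤-trans πτ≤r (ℕ.≤-reflexive (sym (ℕ.+-identityʳ r)))))

-- Common consequence of `AddsEdge` and `MergesTwoComponents`, so that line and clique instances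
-- share one count of the steps.
Joins : Graph V → Graph V → Set
Joins G G′ = ∃₂ λ a b → ¬ Connected G a b × (∀ {x y} → Adj G x y → Adj G′ x y) × Adj G′ a b

merges⇒joins : ∀ {G G′ : Graph V} → MergesTwoComponents G G′ → Joins G G′
merges⇒joins (a , b , a≁b , adj) = a , b , a≁b ,
  Equivalence.from (adj _ _) ∘ inj₁ , Equivalence.from (adj a b) (inj₂ (inj₁ (ε , ε)))

addsEdge⇒joins : ∀ {G G′ : Graph V} → AddsEdge G G′ → Joins G G′
addsEdge⇒joins (a , b , a≁b , adj) = a , b , a≁b ,
  Equivalence.from (adj _ _) ∘ inj₁ , Equivalence.from (adj a b) (inj₂ (inj₁ (refl , refl)))

-- Only this half of "labels classify components" is needed, and the labels
-- need not all occur.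
Labelling : Graph V → ℕ → Set
Labelling {V} G m = ∃ λ (c : V → Fin m) → ∀ {x y} → c x ≡ c y → Connected G x y

-- Glues `j` to `i`: the value `j` is first sent to `i`, and `j`, now no longer hit, is punched out
-- of the range.
identify : ∀ {i j : Fin (suc m)} → j ≢ i → Fin (suc m) → Fin m
identify {j = j} j≢i k with j ≟ k
... | yes _   = punchOut j≢i
... | no  j≢k = punchOut j≢k

-- Since `punchOut` is injective, the gluing is the only source of new coincidences.
identify-kernel : ∀ {i j : Fin (suc m)} (j≢i : j ≢ i) k l → identify j≢i k ≡ identify j≢i l →
                  k ≡ l ⊎ (k ≡ i × l ≡ j) ⊎ (k ≡ j × l ≡ i)
identify-kernel {j = j} j≢i k l eq with j ≟ k | j ≟ l
... | yes j≡k | yes j≡l = inj₁ (trans (sym j≡k) j≡l)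
... | yes j≡k | no  j≢l = inj₂ (inj₂ (sym j≡k , sym (punchOut-injective j≢i j≢l eq)))
... | no  j≢k | yes j≡l = inj₂ (inj₁ (punchOut-injective j≢k j≢i eq , sym j≡l))
... | no  j≢k | no  j≢l = inj₁ (punchOut-injective j≢k j≢l eq)

-- The labels of `a` and `b` are glued. Nodes that only now share a label are linked by a path
-- through the new edge between `a` and `b`.
join-labelling : ∀ {G G′ : Graph V} → Joins G G′ → Labelling G (suc m) → Labelling G′ m
join-labelling {G = G} {G′} (a , b , a≁b , mono , ab) (c , sound) =
  identify cb≢ca ∘ c , sound′ ∘ identify-kernel cb≢ca _ _
  where
  -- Equal labels would already connect `a` and `b` in `G`.
  cb≢ca : c b ≢ c a
  cb≢ca = a≁b ∘ sound ∘ sym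

  connected : ∀ {x y} → c x ≡ c y → Connected G′ x y
  connected = map mono ∘ sound

  sound′ : ∀ {x y} → c x ≡ c y ⊎ (c x ≡ c a × c y ≡ c b) ⊎ (c x ≡ c b × c y ≡ c a) →
           Connected G′ x y
  sound′ (inj₁ x≡y)               = connected x≡y
  sound′ (inj₂ (inj₁ (x≡a , y≡b))) = connected x≡a ◅◅ ab ◅ connected (sym y≡b)
  sound′ (inj₂ (inj₂ (x≡b , y≡a))) = connected x≡b ◅◅ Sum.swap ab ◅ connected (sym y≡a)

-- Each join uses up one label, and under a single label all nodes are already connected, so nothing
-- is left to join.
joins≤labels∸1 : ∀ {k} (G : Fin (suc k) → Graph V) →
                 (∀ i → Joins (G (inject₁ i)) (G (suc i))) →
                 Labelling (G zero) m → k ≤ m ∸ 1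
joins≤labels∸1 {k = zero} G joins labelling = z≤n
-- Without labels there are no nodes, yet a join provides one.
joins≤labels∸1 {m = zero} {k = suc k} G joins (c , _) = contradiction (c (proj₁ (joins zero))) λ ()
joins≤labels∸1 {m = suc zero} {k = suc k} G joins (c , sound) with joins zero
... | a , b , a≁b , _ = contradiction (sound (Fin1-irrelevant (c a) (c b))) a≁b
  where
  Fin1-irrelevant : ∀ (i j : Fin 1) → i ≡ j
  Fin1-irrelevant zero zero = refl
joins≤labels∸1 {m = suc (suc m)} {k = suc k} G joins labelling =
  s≤s (joins≤labels∸1 (G ∘ suc) (joins ∘ suc)
    (join-labelling {G = G zero} {G (suc zero)} (joins zero) labelling))

joins : ∀ (σ : Instance V n) → IsLineInstance σ ⊎ IsCliqueInstance σ →
        ∀ i → Joins (Instance.G σ (inject₁ i)) (Instance.G σ (suc i))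
joins σ (inj₁ (_ , adds))   i = addsEdge⇒joins {G = Instance.G σ (inject₁ i)} {Instance.G σ (suc i)} (adds i)
joins σ (inj₂ (_ , merges)) i = merges⇒joins {G = Instance.G σ (inject₁ i)} {Instance.G σ (suc i)} (merges i)

-- Positions under `π₀` serve as labels: equal positions mean equal nodes, connected by the empty
-- path.
π₀-labelling : ∀ (σ : Instance V n) → Labelling (Instance.G σ zero) n
π₀-labelling σ = Inverse.to π₀ , λ {x} eq → subst (Connected (G zero) x) (injective eq) ε
  where
  open Instance σ
  injective : ∀ {x y} → Inverse.to π₀ x ≡ Inverse.to π₀ y → x ≡ y
  injective eq = trans (sym (Inverse.inverseʳ π₀ refl)) (Inverse.inverseʳ π₀ eq)

det-near-π₀ : ∀ (σ : Instance V n) (π : Solution σ) → IsDetRun σ π →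
              ∀ i → d (Instance.π₀ σ) ((Instance.π₀ σ Vector.∷ π) i) ≤ Opt σ
-- Index zero is `π₀` itself, where the first step of Det starts.
det-near-π₀ σ π det zero    = d-refl-≤ (Instance.π₀ σ)
det-near-π₀ σ π det (suc i) with proj₁ (proj₂ (opt-exists σ))
... | ρ , feasible , cost≡Opt = ℕ.≤-trans (proj₂ (det i) (ρ i) (feasible i))
  (ℕ.≤-trans (d≤∑d (Instance.π₀ σ Vector.∷ ρ) (suc i)) (ℕ.≤-reflexive cost≡Opt))

theorem1 : ∀ {V : Set} {n : ℕ} (σ : Instance V n) →
    IsLineInstance σ ⊎ IsCliqueInstance σ →
    (π : Solution σ) → IsDetRun σ π →
    cost σ π ≤ (2 * n ∸ 2) * Opt σ
theorem1 {n = n} σ kind π det = begin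
  cost σ π                 ≤⟨ ∑-≤ _ step≤ ⟩
  k * (2 * Opt σ)          ≤⟨ ℕ.*-monoˡ-≤ (2 * Opt σ) (joins≤labels∸1 G (joins σ kind) (π₀-labelling σ)) ⟩
  (n ∸ 1) * (2 * Opt σ)    ≡⟨ sym (ℕ.*-assoc (n ∸ 1) 2 (Opt σ)) ⟩
  (n ∸ 1) * 2 * Opt σ      ≡⟨ cong (_* Opt σ) (ℕ.*-comm (n ∸ 1) 2) ⟩
  -- Truncated subtraction makes this hold for `n = 0` as well, both sides being zero.
  2 * (n ∸ 1) * Opt σ      ≡⟨ cong (_* Opt σ) (ℕ.*-distribˡ-∸ 2 n 1) ⟩
  (2 * n ∸ 2) * Opt σ      ∎
  where
  open Instance σ
  open ℕ.≤-Reasoning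
  p = π₀ Vector.∷ π
  step≤ : ∀ i → d (p (inject₁ i)) (p (suc i)) ≤ 2 * Opt σ
  step≤ i = d-ball π₀ (p (inject₁ i)) (p (suc i))
    (det-near-π₀ σ π det (inject₁ i)) (det-near-π₀ σ π det (suc i))
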